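{- Let $m\ge 2$ be an integer and let $n$ be a positive integer with $m^j\le n<m^{j+1}$ for some integer $j\ge 0$. Write the base $m$ representation of $n$ as $n=\alpha_j m^j+\alpha_{j-1}m^{j-1}+\cdots+\alpha_1 m+\alpha_0$ with $\alpha_j>0$ and $0\le \alpha_i\le m-1$ for $0\le i\le j$. Then there is a one-to-one correspondence between the set $\mathcal{B}_m(n)$ of $m$-ary partitions of $n$ and the set of integer sequences \[ \mathcal{S}_m(n)=\{(\beta_j,\beta_{j-1},\ldots,\beta_1)\,:\,0\le \beta_j\le \alpha_j \text{ and } 0\le \beta_t\le \alpha_t+m\beta_{t+1}\text{ for } 1\le t\le j-1\}. \]
   Context: An $m$-ary partition of a positive integer $n$ is a partition of $n$ in which every part is a power of $m$ (i.e. $1,m,m^2,\ldots$). Equivalently, it is a sequence $(a_\ell,a_{\ell-1},\ldots,a_0)$ of integers with $a_\ell>0$, $a_i\ge 0$ for $0\le i\le \ell-1$, and $n=a_\ell m^\ell+\cdots+a_1 m+a_0$ ($a_i$ being the number of parts equal to $m^i$). $\mathcal{B}_m(n)$ denotes the set of all $m$-ary partitions of $n$. -}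

module Defs where

open import Data.Fin using (Fin; suc; toℕ)
open import Data.List using (List; sum)
open import Data.List.Relation.Unary.All using (All)
open import Data.List.Relation.Unary.Linked using (Linked)
open import Data.Nat using (ℕ; suc; _+_; _*_; _^_; _≤_; _≥_; _>_)
open import Data.Product using (∃-syntax; proj₁)
open import Data.Vec using (Vec; lookup; tabulate)
import Data.Vec as Vec
open import Level using (0ℓ)
open import Relation.Binary.Bundles using (Setoid)
import Relation.Binary.Construct.On as On
open import Relation.Binary.PropositionalEquality using (_≡_; setoid)
open import Relation.Unary using (Pred)

-- The subset { x | P x } of A: membership proofs are ignored when comparing
-- elements.
subset : {A : Set} → Pred A 0ℓ → Setoid 0ℓ 0ℓ
subset {A} P = On.setoid (setoid A) (proj₁ {B = P})

-- Weakly decreasing lists, so that ≡ is equality of partitions.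
record IsPartition (n : ℕ) (ps : List ℕ) : Set where
  field
    decreasing : Linked _≥_ ps
    positive   : All (_> 0) ps
    sum≡       : sum ps ≡ n

record IsMAryPartition (m n : ℕ) (ps : List ℕ) : Set where
  field
    isPartition : IsPartition n ps
    powers      : All (λ p → ∃[ k ] p ≡ m ^ k) ps

ℬ : (m n : ℕ) → Setoid 0ℓ 0ℓ
ℬ m n = subset (IsMAryPartition m n)

-- α₀ + α₁ m + ⋯ + αⱼ mʲ
value : (m : ℕ) {j : ℕ} → (Fin (suc j) → ℕ) → ℕ
value m α = Vec.sum (tabulate (λ i → α i * m ^ toℕ i))

-- The sequence (βⱼ , … , β₁) is stored from the low end: β_t with 1 ≤ t ≤ j is
-- the entry at the position i with toℕ i = t - 1, and α_t is then α (suc i).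
-- The lower bounds 0 ≤ β_t are built into ℕ.
record IsBounded (m : ℕ) {j : ℕ} (α : Fin (suc j) → ℕ) (β : Vec ℕ j) : Set where
  field
    top   : ∀ (i : Fin j) → suc (toℕ i) ≡ j → lookup β i ≤ α (suc i)
    below : ∀ (i i⁺ : Fin j) → toℕ i⁺ ≡ suc (toℕ i) →
            lookup β i ≤ α (suc i) + m * lookup β i⁺

𝒮 : (m : ℕ) {j : ℕ} → (Fin (suc j) → ℕ) → Setoid 0ℓ 0ℓ
𝒮 m α = subset (IsBounded m α)

{-# OPTIONS --safe #-}

-- Subtracting the value of a partition with aᵢ parts equal to mⁱ from that of
-- α, digit by digit from the low end, leaves at position t the borrow β_t
-- determined by aₜ + β_t = αₜ + m β_{t+1}, with β₀ = 0 and β_{j+1} = 0. So β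
-- determines a, and the condition aₜ ≥ 0 is exactly the bound on β_t.
-- Conversely αₜ < m makes every borrow of a representation of n nonnegative.
module Submission where

import Algebra.Properties.CommutativeSemigroup as CommutativeSemigroupProperties
open import Data.Fin using (Fin; zero; suc; fromℕ; toℕ)
open import Data.List using (List; []; _∷_; _++_; map; replicate)
open import Data.List.Properties using (∷-injective)
open import Data.List.Relation.Unary.All as All using (All; []; _∷_)
import Data.List.Relation.Unary.All.Properties as All
open import Data.List.Relation.Unary.AllPairs as AllPairs using (AllPairs; []; _∷_)
import Data.List.Relation.Unary.AllPairs.Properties as AllPairs
open import Data.List.Relation.Unary.Linked.Properties
  using (AllPairs⇒Linked; Linked⇒AllPairs)
open import Data.Nat
open import Data.Nat.ListAction using (sum)
open import Data.Nat.ListAction.Properties using (sum-++)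
open import Data.Nat.Properties
open import Data.Nat.Tactic.RingSolver using (solve-∀)
open import Data.Product using (∃-syntax; _×_; _,_; proj₁; proj₂)
open import Data.Vec using (Vec; []; _∷_; tabulate)
import Data.Vec as Vec
open import Data.Vec.Properties using (tabulate-cong)
import Data.Vec.Properties as Vec
import Data.Vec.Relation.Unary.All as VecAll
import Data.Vec.Relation.Unary.All.Properties as VecAll
open import Function using (_∘_; flip)
open import Function.Bundles using (Bijection)
import Function.Construct.Symmetry as Symmetry
open import Function.Properties.Bijection using (Bijection⇒Inverse)
open import Function.Properties.Inverse using (Inverse⇒Bijection)
open import Relation.Binary.PropositionalEquality
open import Relation.Nullary using (contradiction)
open import Defs

open CommutativeSemigroupProperties +-commutativeSemigroup using (xy∙z≈xz∙y)

-- Sums and order of lists.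

sum-map-* : ∀ m ns → sum (map (m *_) ns) ≡ m * sum ns
sum-map-* m []       = sym (*-zeroʳ m)
sum-map-* m (n ∷ ns) = trans (cong (m * n +_) (sum-map-* m ns)) (sym (*-distribˡ-+ m n (sum ns)))

sum-replicate-1 : ∀ n → sum (replicate n 1) ≡ n
sum-replicate-1 zero    = refl
sum-replicate-1 (suc n) = cong suc (sum-replicate-1 n)

all≤sum : ∀ ns → All (_≤ sum ns) ns
all≤sum []       = []
all≤sum (n ∷ ns) =
  m≤m+n n (sum ns) ∷ All.map (λ p → ≤-trans p (m≤n+m (sum ns) n)) (all≤sum ns)

replicate-decreasing : ∀ n k → AllPairs _≥_ (replicate n k)
replicate-decreasing zero    k = []
replicate-decreasing (suc n) k = All.replicate⁺ n ≤-refl ∷ replicate-decreasing n k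

module _ (m : ℕ) where

  -- Values in base `m`, in Horner form with the low digit first.

  weight : ∀ {k} → Vec ℕ k → ℕ
  weight []       = 0
  weight (a ∷ as) = a + m * weight as

  -- The factor `c` absorbs the power of `m` belonging to the digits already passed, so the
  -- induction hypothesis applies at `c * m`.
  sum-scaled≡weight : ∀ {k} c (α : Fin k → ℕ) →
    Vec.sum (tabulate (λ i → α i * (c * m ^ toℕ i))) ≡ c * weight (tabulate α)
  sum-scaled≡weight {zero}  c α = sym (*-zeroʳ c)
  sum-scaled≡weight {suc k} c α = begin
    α zero * (c * 1) + Vec.sum (tabulate (λ i → α (suc i) * (c * (m * m ^ toℕ i))))
      ≡⟨ cong₂ _+_ (cong (α zero *_) (*-identityʳ c)) (cong Vec.sum (tabulate-cong
           (λ i → cong (α (suc i) *_) (sym (*-assoc c m (m ^ toℕ i)))))) ⟩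
    α zero * c + Vec.sum (tabulate (λ i → α (suc i) * (c * m * m ^ toℕ i)))
      ≡⟨ cong (α zero * c +_) (sum-scaled≡weight (c * m) (α ∘ suc)) ⟩
    α zero * c + c * m * weight (tabulate (α ∘ suc))
      ≡⟨ factor (α zero) c m (weight (tabulate (α ∘ suc))) ⟩
    c * (α zero + m * weight (tabulate (α ∘ suc))) ∎
    where
    open ≡-Reasoning
    factor : ∀ a c m w → a * c + c * m * w ≡ c * (a + m * w)
    factor = solve-∀

  value≡weight : ∀ {j} (α : Fin (suc j) → ℕ) → value m α ≡ weight (tabulate α)
  value≡weight α = begin
    value m α
      ≡⟨ cong Vec.sum (tabulate-cong (λ i → cong (α i *_) (sym (*-identityˡ (m ^ toℕ i))))) ⟩
    Vec.sum (tabulate (λ i → α i * (1 * m ^ toℕ i)))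
      ≡⟨ sum-scaled≡weight 1 α ⟩
    1 * weight (tabulate α)
      ≡⟨ *-identityˡ _ ⟩
    weight (tabulate α) ∎
    where open ≡-Reasoning

  -- Borrow sequences and the counts they determine.

  -- A borrow sequence, with the lowest borrow b kept apart from the others.
  data Bounded : ∀ {j} → Vec ℕ (suc j) → ℕ → Vec ℕ j → Set where
    [_] : ∀ {α b} → b ≤ α → Bounded (α ∷ []) b []
    _∷_ : ∀ {j α b β} {αs : Vec ℕ (suc j)} {βs} →
          b ≤ α + m * β → Bounded αs β βs → Bounded (α ∷ αs) b (β ∷ βs)

  -- Here `b` is β₁, whose bound starts from α₁; hence the shift to `α ∘ suc`.
  isBounded-∷⇒bounded : ∀ {j} (α : Fin (suc (suc j)) → ℕ) b βs →
    IsBounded m α (b ∷ βs) → Bounded (tabulate (α ∘ suc)) b βs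
  isBounded-∷⇒bounded α b []       B = [ IsBounded.top B zero refl ]
  isBounded-∷⇒bounded α b (β ∷ βs) B =
    below zero (suc zero) refl ∷ isBounded-∷⇒bounded (α ∘ suc) β βs record
      { top   = λ i eq → top (suc i) (cong suc eq)
      ; below = λ i i⁺ eq → below (suc i) (suc i⁺) (cong suc eq)
      }
    where open IsBounded B

  bounded⇒isBounded-∷ : ∀ {j} (α : Fin (suc (suc j)) → ℕ) b βs →
    Bounded (tabulate (α ∘ suc)) b βs → IsBounded m α (b ∷ βs)
  bounded⇒isBounded-∷ α b [] [ b≤α ] = record
    { top   = λ { zero _ → b≤α }
    ; below = λ { zero zero () }
    }
  bounded⇒isBounded-∷ α b (β ∷ βs) (b≤ ∷ B) = record
    { top   = λ { zero () ; (suc i) eq → top i (suc-injective eq) }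
    ; below = λ { zero    zero           ()
                ; zero    (suc zero)     _  → b≤
                ; zero    (suc (suc _))  ()
                ; (suc i) zero           ()
                ; (suc i) (suc i⁺)       eq → below i i⁺ (suc-injective eq) }
    }
    where open IsBounded (bounded⇒isBounded-∷ (α ∘ suc) β βs B)

  isBounded⇒bounded : ∀ {j} (α : Fin (suc j) → ℕ) {β} →
    IsBounded m α β → Bounded (tabulate α) 0 β
  isBounded⇒bounded α {[]}    B = [ z≤n ]
  -- The prepended borrow is β₀ = 0, which meets its bound trivially.
  isBounded⇒bounded α {b ∷ β} B = z≤n ∷ isBounded-∷⇒bounded α b β B

  bounded⇒isBounded : ∀ {j} (α : Fin (suc j) → ℕ) {β} →
    Bounded (tabulate α) 0 β → IsBounded m α β
  bounded⇒isBounded α {[]}    B       = record { top = λ () ; below = λ () }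
  bounded⇒isBounded α {b ∷ β} (_ ∷ B) = bounded⇒isBounded-∷ α b β B

  -- The truncated subtractions are exact only on Bounded sequences.
  counts : ∀ {j} → Vec ℕ (suc j) → ℕ → Vec ℕ j → Vec ℕ (suc j)
  counts (α ∷ αs) b (β ∷ βs) = α + m * β ∸ b ∷ counts αs β βs
  counts (α ∷ []) b []       = α ∸ b ∷ []

  -- The sum telescopes: the `m * β` gained by one digit is the `β` taken from the digits above it,
  -- so only the lowest borrow `b` is lost.
  weight-counts : ∀ {j} {αs : Vec ℕ (suc j)} {b βs} →
    Bounded αs b βs → weight (counts αs b βs) + b ≡ weight αs
  weight-counts {αs = α ∷ []} {b} [ b≤α ] = begin
    α ∸ b + m * 0 + b    ≡⟨ xy∙z≈xz∙y (α ∸ b) (m * 0) b ⟩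
    α ∸ b + b + m * 0    ≡⟨ cong (_+ m * 0) (m∸n+n≡m b≤α) ⟩
    α + m * 0            ∎
    where open ≡-Reasoning
  weight-counts {αs = α ∷ αs} {b} {β ∷ βs} (b≤ ∷ B) = begin
    α + m * β ∸ b + m * w + b      ≡⟨ xy∙z≈xz∙y (α + m * β ∸ b) (m * w) b ⟩
    α + m * β ∸ b + b + m * w      ≡⟨ cong (_+ m * w) (m∸n+n≡m b≤) ⟩
    α + m * β + m * w              ≡⟨ factor α m β w ⟩
    α + m * (w + β)                ≡⟨ cong (λ v → α + m * v) (weight-counts B) ⟩
    α + m * weight αs              ∎
    where
    open ≡-Reasoning
    w = weight (counts αs β βs)
    factor : ∀ a m b w → a + m * b + m * w ≡ a + m * (w + b)
    factor = solve-∀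

  -- From counts to partitions.

  parts : ∀ {k} → Vec ℕ k → List ℕ
  parts []       = []
  -- The ones come last, to make the list weakly decreasing.
  parts (a ∷ as) = map (m *_) (parts as) ++ replicate a 1

  sum-parts : ∀ {k} (as : Vec ℕ k) → sum (parts as) ≡ weight as
  sum-parts []       = refl
  sum-parts (a ∷ as) = begin
    sum (map (m *_) (parts as) ++ replicate a 1)
      ≡⟨ sum-++ (map (m *_) (parts as)) (replicate a 1) ⟩
    sum (map (m *_) (parts as)) + sum (replicate a 1)
      ≡⟨ cong₂ _+_ (sum-map-* m (parts as)) (sum-replicate-1 a) ⟩
    m * sum (parts as) + a
      ≡⟨ cong (λ s → m * s + a) (sum-parts as) ⟩
    m * weight as + a
      ≡⟨ +-comm (m * weight as) a ⟩
    a + m * weight as ∎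
    where open ≡-Reasoning

  parts-powers : ∀ {k} (as : Vec ℕ k) → All (λ p → ∃[ e ] p ≡ m ^ e) (parts as)
  parts-powers []       = []
  parts-powers (a ∷ as) = All.++⁺
    (All.map⁺ (All.map (λ (e , eq) → suc e , cong (m *_) eq) (parts-powers as)))
    (All.replicate⁺ a (0 , refl))

  module _ .{{_ : NonZero m}} where

    powers-positive : ∀ {ps} → All (λ p → ∃[ e ] p ≡ m ^ e) ps → All (_> 0) ps
    powers-positive = All.map (λ { (e , refl) → m^n>0 m e })

    parts-decreasing : ∀ {k} (as : Vec ℕ k) → AllPairs _≥_ (parts as)
    parts-decreasing []       = []
    parts-decreasing (a ∷ as) = AllPairs.++⁺
      (AllPairs.map⁺ (AllPairs.map (*-monoʳ-≤ m) (parts-decreasing as)))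
      (replicate-decreasing a 1)
      -- Each scaled part is a product of two positive numbers, hence at least every appended 1.
      (All.map⁺ (All.map (λ p>0 → All.replicate⁺ a (*-mono-≤ (>-nonZero⁻¹ m) p>0))
        (powers-positive (parts-powers as))))

    parts-isMAryPartition : ∀ {k} (as : Vec ℕ k) → IsMAryPartition m (weight as) (parts as)
    parts-isMAryPartition as = record
      { isPartition = record
        { decreasing = AllPairs⇒Linked (parts-decreasing as)
        ; positive   = powers-positive (parts-powers as)
        ; sum≡       = sum-parts as
        }
      ; powers = parts-powers as
      }

    -- The correspondence between borrows and counts.

    counts-injective : ∀ {j} {αs : Vec ℕ (suc j)} {b βs βs′} →
      Bounded αs b βs → Bounded αs b βs′ → counts αs b βs ≡ counts αs b βs′ → βs ≡ βs′
    counts-injective [ _ ] [ _ ] _ = refl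
    -- The bounds make both subtractions exact, so equal low counts force `m * β ≡ m * β′`.
    counts-injective {αs = α ∷ _} {βs = β ∷ _} {βs′ = β′ ∷ _} (b≤ ∷ B) (b≤′ ∷ B′) eq
      with refl ← *-cancelˡ-≡ β β′ m (+-cancelˡ-≡ α (m * β) (m * β′)
             (∸-cancelʳ-≡ b≤ b≤′ (Vec.∷-injectiveˡ eq)))
      = cong (β ∷_) (counts-injective B B′ (Vec.∷-injectiveʳ eq))

    -- The next borrow is forced: it is the excess of the higher digits of α over the higher counts.
    -- Each bound then holds because α + m β equals a + b, which is at least b.
    counts-surjective : ∀ {j} {αs : Vec ℕ (suc j)} → VecAll.All (_< m) αs →
      ∀ b as → weight as + b ≡ weight αs → ∃[ βs ] Bounded αs b βs × counts αs b βs ≡ as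
    counts-surjective {αs = α ∷ []} _ b (a ∷ []) eq =
      [] , [ subst (b ≤_) a+b≡α (m≤n+m b a) ] ,
      cong (_∷ []) (trans (cong (_∸ b) (sym a+b≡α)) (m+n∸n≡m a b))
      where
      a+b≡α : a + b ≡ α
      a+b≡α = +-cancelʳ-≡ (m * 0) (a + b) α (trans (xy∙z≈xz∙y a b (m * 0)) eq)
    counts-surjective {αs = α ∷ αs@(_ ∷ _)} (α<m VecAll.∷ αs<m) b (a ∷ as) eq =
      let βs , B , counts≡as = counts-surjective αs<m β as w+β≡v in
      β ∷ βs , subst (b ≤_) a+b≡ (m≤n+m b a) ∷ B ,
      cong₂ _∷_ (trans (cong (_∸ b) (sym a+b≡)) (m+n∸n≡m a b)) counts≡as
      where
      w v β : ℕ
      w = weight as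
      v = weight αs
      β = v ∸ w

      w≤v : w ≤ v
      -- A negative excess is excluded by `α < m`: it gives m w < m (v + 1), hence w < v + 1.
      w≤v = s≤s⁻¹ (*-cancelˡ-< m w (suc v) (begin-strict
        m * w          ≤⟨ m≤n+m (m * w) a ⟩
        a + m * w      ≤⟨ m≤m+n (a + m * w) b ⟩
        a + m * w + b  ≡⟨ eq ⟩
        α + m * v      <⟨ +-monoˡ-< (m * v) α<m ⟩
        m + m * v      ≡⟨ *-suc m v ⟨
        m * suc v      ∎))
        where open ≤-Reasoning

      w+β≡v : w + β ≡ v
      w+β≡v = m+[n∸m]≡n w≤v

      a+b≡ : a + b ≡ α + m * β
      a+b≡ = +-cancelʳ-≡ (m * w) (a + b) (α + m * β) (begin
        a + b + m * w        ≡⟨ xy∙z≈xz∙y a b (m * w) ⟩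
        a + m * w + b        ≡⟨ eq ⟩
        α + m * v            ≡⟨ cong (λ u → α + m * u) (sym w+β≡v) ⟩
        α + m * (w + β)      ≡⟨ expand α m w β ⟩
        α + m * β + m * w    ∎)
        where
        open ≡-Reasoning
        expand : ∀ a m w b → a + m * (w + b) ≡ a + m * b + m * w
        expand = solve-∀

  -- Recovering counts from a partition, for `m` at least 2.

  module _ .{{_ : NonTrivial m}} where

    private instance
      m≢0 : NonZero m
      m≢0 = nonTrivial⇒nonZero m

    m*n≢1 : ∀ n → m * n ≢ 1
    m*n≢1 n eq = nonTrivial⇒≢1 (m*n≡1⇒m≡1 m n eq)

    -- No multiple of `m` is 1, so the place where the ones begin can be read off the list.
    map-++-replicate-injective : ∀ xs ys a b →
      map (m *_) xs ++ replicate a 1 ≡ map (m *_) ys ++ replicate b 1 → xs ≡ ys × a ≡ b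
    map-++-replicate-injective [] [] zero zero eq = refl , refl
    map-++-replicate-injective [] [] (suc a) (suc b) eq =
      let _ , a≡b = map-++-replicate-injective [] [] a b (proj₂ (∷-injective eq))
      in refl , cong suc a≡b
    map-++-replicate-injective [] (y ∷ _) (suc a) b eq =
      contradiction (sym (proj₁ (∷-injective eq))) (m*n≢1 y)
    map-++-replicate-injective (x ∷ _) [] a (suc b) eq =
      contradiction (proj₁ (∷-injective eq)) (m*n≢1 x)
    map-++-replicate-injective (x ∷ xs) (y ∷ ys) a b eq =
      let mx≡my , eq′ = ∷-injective eq
          xs≡ys , a≡b = map-++-replicate-injective xs ys a b eq′
      in cong₂ _∷_ (*-cancelˡ-≡ x y m mx≡my) xs≡ys , a≡b

    parts-injective : ∀ {k} (as as′ : Vec ℕ k) → parts as ≡ parts as′ → as ≡ as′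
    parts-injective []       []         eq = refl
    parts-injective (a ∷ as) (a′ ∷ as′) eq =
      let eq′ , a≡a′ = map-++-replicate-injective (parts as) (parts as′) a a′ eq
      in cong₂ _∷_ a≡a′ (parts-injective as as′ eq′)

    -- The bound on the exponent ensures that `k` counts suffice.
    PowerBelow : ℕ → ℕ → Set
    PowerBelow k p = ∃[ e ] e < k × p ≡ m ^ e

    ones : ∀ {k ps} → All (PowerBelow k) ps → All (1 ≥_) ps → ∃[ a ] ps ≡ replicate a 1
    ones []                    []          = 0 , refl
    ones ((e , _ , refl) ∷ ps) (p≤1 ∷ ps≤1) =
      let a , eq = ones ps ps≤1 in suc a , cong₂ _∷_ (≤-antisym p≤1 (m^n>0 m e)) eq

    -- In a decreasing list of powers, everything after a 1 is again 1; the parts before it are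
    -- multiples of `m`, and dividing them by `m` lowers each exponent by one.
    split-ones : ∀ {k ps} → AllPairs _≥_ ps → All (PowerBelow (suc k)) ps →
      ∃[ qs ] ∃[ a ] ps ≡ map (m *_) qs ++ replicate a 1 ×
        AllPairs _≥_ qs × All (PowerBelow k) qs
    split-ones [] [] = [] , 0 , refl , [] , []
    split-ones (p≥ ∷ _) ((zero , _ , refl) ∷ pows) =
      let a , eq = ones pows p≥ in [] , suc a , cong (1 ∷_) eq , [] , []
    split-ones (p≥ ∷ dec) ((suc e , e<k , refl) ∷ pows) with split-ones dec pows
    ... | qs , a , refl , dec′ , pows′ =
      m ^ e ∷ qs , a , refl ,
      All.map (*-cancelˡ-≤ m) (All.map⁻ (All.++⁻ˡ (map (m *_) qs) p≥)) ∷ dec′ ,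
      (e , s≤s⁻¹ e<k , refl) ∷ pows′

    parts-surjective : ∀ k {ps} → AllPairs _≥_ ps → All (PowerBelow k) ps →
      ∃[ as ] parts {k} as ≡ ps
    parts-surjective zero    []  []   = [] , refl
    -- No exponent is below 0, so only the empty list is left.
    parts-surjective zero    _   ((_ , () , _) ∷ _)
    parts-surjective (suc k) dec pows with split-ones dec pows
    ... | qs , a , refl , dec′ , pows′ =
      let as , eq = parts-surjective k dec′ pows′
      in a ∷ as , cong (λ xs → map (m *_) xs ++ replicate a 1) eq

    -- A part is at most the sum n, so an exponent of `k` or more would give a part exceeding n.
    bounded-powers : ∀ {k n ps} → n < m ^ k → IsMAryPartition m n ps → All (PowerBelow k) ps
    bounded-powers {k} {ps = ps} n<m^k P =
      All.zipWith below (IsMAryPartition.powers P , all≤sum ps)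
      where
      open IsPartition (IsMAryPartition.isPartition P) using (sum≡)
      below : ∀ {p} → (∃[ e ] p ≡ m ^ e) × p ≤ sum ps → PowerBelow k p
      below ((e , refl) , m^e≤) = e , ≰⇒> (λ k≤e → <⇒≱ n<m^k
        (≤-trans (^-monoʳ-≤ m k≤e) (subst (m ^ e ≤_) sum≡ m^e≤))) , refl

    -- The bijection.

    𝒮⤖ℬ : ∀ {j} (α : Fin (suc j) → ℕ) → value m α < m ^ suc j → (∀ i → α i < m) →
      Bijection (𝒮 m α) (ℬ m (value m α))
    𝒮⤖ℬ {j} α n<m^ α<m = record
      { to        = to
      -- The map depends on the sequence only, not on the proof of its bounds; the 0 is β₀.
      ; cong      = cong (parts ∘ counts αs 0)
      ; bijective =
          (λ {(β , B)} {(β′ , B′)} eq → counts-injective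
            (isBounded⇒bounded α B) (isBounded⇒bounded α B′) (parts-injective _ _ eq)) ,
          λ (ps , P) → let (β , B) , eq = surjective ps P in
            (β , B) , λ z≈ → trans (cong (parts ∘ counts αs 0) z≈) eq
      }
      where
      αs = tabulate α

      weight≡ : ∀ {β} → IsBounded m α β → weight (counts αs 0 β) ≡ value m α
      weight≡ B = trans (sym (+-identityʳ _))
        (trans (weight-counts (isBounded⇒bounded α B)) (sym (value≡weight α)))

      to : (∃[ β ] IsBounded m α β) → ∃[ ps ] IsMAryPartition m (value m α) ps
      to (β , B) = parts (counts αs 0 β) ,
        subst (λ n → IsMAryPartition m n (parts (counts αs 0 β))) (weight≡ B)
          (parts-isMAryPartition (counts αs 0 β))

      surjective : ∀ ps → IsMAryPartition m (value m α) ps →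
        ∃[ βB ] parts (counts αs 0 (proj₁ {B = IsBounded m α} βB)) ≡ ps
      surjective ps P =
        let open IsPartition (IsMAryPartition.isPartition P)
            -- As n is below the power of `m` with exponent `suc j`, every part has exponent at most
            -- `j`.
            as , parts≡ = parts-surjective (suc j)
              (Linked⇒AllPairs (flip ≤-trans) decreasing) (bounded-powers n<m^ P)
            weight≡ = trans (sym (sum-parts as))
              (trans (cong sum parts≡) (trans sum≡ (value≡weight α)))
            β , B , counts≡ = counts-surjective (VecAll.tabulate⁺ α<m) 0 as
              (trans (+-identityʳ _) weight≡)
        in (β , bounded⇒isBounded α B) , trans (cong parts counts≡) parts≡

theorem1p1 : ∀ (m : ℕ) → m ≥ 2 → ∀ (n : ℕ) → n > 0 →
    ∀ (j : ℕ) → m ^ j ≤ n → n < m ^ suc j →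
    ∀ (α : Fin (suc j) → ℕ) → n ≡ value m α →
    α (fromℕ j) > 0 → (∀ i → α i < m) →
    Bijection (ℬ m n) (𝒮 m α)
theorem1p1 m m≥2 _ _ j _ n<m^ α refl _ α<m =
  -- The explicit map runs from borrow sequences to partitions, so it is inverted here.
  Inverse⇒Bijection (Symmetry.inverse (Bijection⇒Inverse (𝒮⤖ℬ m α n<m^ α<m)))
  where instance _ = n>1⇒nonTrivial m≥2
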